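{- A group is poly-growth automatic if, and only if, it is finite.
   Context: Groups are viewed as structures $\langle G,\cdot,{}^{ -1},e\rangle$. Let $\Sigma$ be a finite alphabet and $\Box\notin\Sigma$. The convolution $w_0\otimes\cdots\otimes w_{n-1}$ of words $w_i\in\Sigma^*$ is the word over $(\Sigma\cup\{\Box\})^n$ of length $\max_i|w_i|$ whose $j$-th letter is the tuple of the $j$-th letters of the $w_i$, with $\Box$ in component $i$ if $w_i$ is too short. A relation $R\subseteq(\Sigma^*)^n$ is regular if $\{w_0\otimes\cdots\otimes w_{n-1} : \langle w_0,\dots,w_{n-1}\rangle\in R\}$ is a regular language. An automatic presentation of a relational structure $\mathfrak A$ is a structure isomorphic to $\mathfrak A$ whose universe is a regular language $L\subseteq\Sigma^*$, for some finite alphabet $\Sigma$, and all of whose relations are regular. For structures with functions, each function is replaced by its graph. $\mathfrak A$ is poly-growth automatic (an automatic structure of polynomial growth) if it has an automatic presentation with universe $L$ for which there is a polynomial $p$ with $|\{w\in L : |w|\le n\}|\le p(n)$ for all $n<\omega$. (This is not Thurston's notion of an automatic group.) -}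

module Defs where

open import Algebra.Bundles using (Group)
open import Data.Fin.Base using (Fin)
open import Data.Fin.Subset using (Subset; _∈_)
open import Data.List.Base using (List; foldl; foldr; length; head; drop; applyUpTo)
open import Data.Maybe.Base using (Maybe)
open import Data.Nat.Base using (ℕ; zero; suc; _+_; _*_; _≤_; _⊔_)
open import Data.Product.Base using (Σ; ∃; ∃-syntax; _×_; _,_; proj₁)
open import Data.Vec.Base as Vec using (Vec; []; _∷_)
open import Data.Vec.Relation.Binary.Pointwise.Inductive as Pointwise
  using (Pointwise; []; _∷_; Pointwise-≡⇒≡)
open import Data.Vec.Relation.Unary.All using (All)
open import Function.Base using (id)
open import Function.Bundles using (Injection; Inverse; _⇔_)
open import Level using (Level; 0ℓ) renaming (_⊔_ to _⊔ˡ_; suc to lsuc)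
open import Relation.Binary.Bundles using (Setoid)
import Relation.Binary.Construct.On as On
open import Relation.Binary.PropositionalEquality using (_≡_; subst)
import Relation.Binary.PropositionalEquality.Properties as ≡
open import Relation.Unary using (Pred)

private
  variable
    a ℓ r b ℓ′ r′ : Level

record DFA (A : Set) : Set where
  field
    states    : ℕ
    start     : Fin states
    δ         : Fin states → A → Fin states
    accepting : Subset states

  Accepts : Pred (List A) 0ℓ
  Accepts w = foldl δ start w ∈ accepting

Regular : {A : Set} → Pred (List A) ℓ → Set ℓ
Regular {A = A} L = Σ (DFA A) λ M → ∀ w → L w ⇔ DFA.Accepts M w

Word : ℕ → Set
Word k = List (Fin k)

maxLength : {A : Set} {n : ℕ} → Vec (List A) n → ℕ
maxLength ws = Vec.foldr′ _⊔_ 0 (Vec.map length ws)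

-- Letters of a convolution are tuples over Σ ∪ {□}, with □ encoded as
-- `nothing`; `head (drop j w)` is the j-th letter of w, or □ if w is
-- too short.
convolution : {A : Set} {n : ℕ} → Vec (List A) n → List (Vec (Maybe A) n)
convolution ws =
  applyUpTo (λ j → Vec.map (λ w → head (drop j w)) ws) (maxLength ws)

RegularRelation : {A : Set} {n : ℕ} → Pred (Vec (List A) n) ℓ → Set ℓ
RegularRelation R = Regular λ u → ∃[ ws ] R ws × u ≡ convolution ws

record Signature : Set₁ where
  field
    Symbol : Set
    arity  : Symbol → ℕ

open Signature public

-- The equality of a structure is the equivalence of its setoid.
record Structure (S : Signature) (a ℓ r : Level) : Set (lsuc (a ⊔ˡ ℓ ⊔ˡ r)) where
  field
    setoid : Setoid a ℓ

  open Setoid setoid public using (Carrier; _≈_)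

  field
    rel      : (s : Symbol S) → Pred (Vec Carrier (arity S s)) r
    rel-resp : (s : Symbol S) {xs ys : Vec Carrier (arity S s)} →
               Pointwise _≈_ xs ys → rel s xs → rel s ys

record _≅_ {S : Signature} (𝔄 : Structure S a ℓ r) (𝔅 : Structure S b ℓ′ r′) :
           Set (a ⊔ˡ ℓ ⊔ˡ r ⊔ˡ b ⊔ˡ ℓ′ ⊔ˡ r′) where
  private
    module 𝔄 = Structure 𝔄
    module 𝔅 = Structure 𝔅
  field
    bijection : Inverse 𝔄.setoid 𝔅.setoid

  open Inverse bijection public using (to; from)

  field
    rel-⇔ : (s : Symbol S) (xs : Vec 𝔄.Carrier (arity S s)) →
            𝔄.rel s xs ⇔ 𝔅.rel s (Vec.map to xs)

-- Membership proofs are ignored: elements are equal iff their words are.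
languageSetoid : {A : Set} → Pred (List A) ℓ → Setoid ℓ 0ℓ
languageSetoid {A = A} L = On.setoid (≡.setoid (List A)) (proj₁ {B = L})

record WordStructure (S : Signature) (k : ℕ) : Set₁ where
  field
    universe : Pred (Word k) 0ℓ
    relation : (s : Symbol S) → Pred (Vec (Word k) (arity S s)) 0ℓ
    within   : (s : Symbol S) {ws : Vec (Word k) (arity S s)} →
               relation s ws → All universe ws

  structure : Structure S 0ℓ 0ℓ 0ℓ
  structure = record
    { setoid   = languageSetoid universe
    ; rel      = λ s xs → relation s (Vec.map proj₁ xs)
    ; rel-resp = λ s xs≈ys →
        subst (relation s) (Pointwise-≡⇒≡ (Pointwise.map⁺ id xs≈ys))
    }

record AutomaticPresentation {S : Signature} (𝔄 : Structure S a ℓ r) :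
                             Set (lsuc 0ℓ ⊔ˡ a ⊔ˡ ℓ ⊔ˡ r) where
  field
    alphabetSize  : ℕ
    wordStructure : WordStructure S alphabetSize

  open WordStructure wordStructure public

  field
    universe-regular : Regular universe
    relation-regular : (s : Symbol S) → RegularRelation (relation s)
    isomorphic       : structure ≅ 𝔄

-- Coefficients are listed from the constant term upwards. Natural
-- coefficients suffice for upper bounds: any real polynomial is bounded
-- on ℕ by one of these.
Polynomial : Set
Polynomial = List ℕ

eval : Polynomial → ℕ → ℕ
eval p n = foldr (λ c v → c + n * v) 0 p

_HasAtMost_Elements : Setoid a ℓ → ℕ → Set (a ⊔ˡ ℓ)
X HasAtMost m Elements = Injection X (≡.setoid (Fin m))

PolynomialGrowth : {A : Set} → Pred (List A) ℓ → Set ℓ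
PolynomialGrowth L = ∃[ p ] ∀ n →
  languageSetoid (λ w → L w × length w ≤ n) HasAtMost eval p n Elements

PolyGrowthAutomatic : {S : Signature} → Structure S a ℓ r →
                      Set (lsuc 0ℓ ⊔ˡ a ⊔ˡ ℓ ⊔ˡ r)
PolyGrowthAutomatic 𝔄 =
  Σ (AutomaticPresentation 𝔄) λ P →
    PolynomialGrowth (AutomaticPresentation.universe P)

data GroupSymbol : Set where
  product inverse identity : GroupSymbol

groupSignature : Signature
groupSignature = record
  { Symbol = GroupSymbol
  ; arity  = λ { product → 3 ; inverse → 2 ; identity → 1 }
  }

-- ⟨G, ·, ⁻¹, e⟩ with each operation replaced by its graph.
module _ (G : Group a ℓ) where
  open Group G

  groupRel : (s : GroupSymbol) → Pred (Vec Carrier (arity groupSignature s)) ℓ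
  groupRel product  (x ∷ y ∷ z ∷ []) = x ∙ y ≈ z
  groupRel inverse  (x ∷ y ∷ [])     = x ⁻¹ ≈ y
  groupRel identity (x ∷ [])         = ε ≈ x

  groupRel-resp : (s : GroupSymbol) {xs ys : Vec Carrier (arity groupSignature s)} →
                  Pointwise _≈_ xs ys → groupRel s xs → groupRel s ys
  groupRel-resp product  {_ ∷ _ ∷ _ ∷ []} {_ ∷ _ ∷ _ ∷ []} (x≈ ∷ y≈ ∷ z≈ ∷ []) xy≈z =
    trans (sym (∙-cong x≈ y≈)) (trans xy≈z z≈)
  groupRel-resp inverse  {_ ∷ _ ∷ []} {_ ∷ _ ∷ []} (x≈ ∷ y≈ ∷ []) x⁻¹≈y =
    trans (sym (⁻¹-cong x≈)) (trans x⁻¹≈y y≈)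
  groupRel-resp identity {_ ∷ []} {_ ∷ []} (x≈ ∷ []) ε≈x = trans ε≈x x≈

  groupStructure : Structure groupSignature a ℓ ℓ
  groupStructure = record
    { setoid   = setoid
    ; rel      = groupRel
    ; rel-resp = groupRel-resp
    }

Finite : Setoid a ℓ → Set (a ⊔ˡ ℓ)
Finite X = ∃[ n ] Inverse (≡.setoid (Fin n)) X

{-# OPTIONS --safe #-}
module Submission where

-- Let s and t be the numbers of states of automata for the universe L and for
-- the graph of multiplication. Excising loops from runs shows two things: every
-- long word of L can be shortened in steps of at most s letters, and, since in
-- x ∙ y ≈ z any two of the elements determine the third, no component is more
-- than t letters longer than both of the others. So if P is a set of N words of
-- length at most m, and g ∈ L has length between m + t and m + t + s, then
-- P ∪ P ∙ g has 2N elements (if p ∙ g ≈ q for p, q ∈ P, then g would be too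
-- short), all of length at most m + 2t + s. Hence, if L contained arbitrarily
-- long words, it would have exponential growth.

open import Algebra.Bundles using (Group)
open import Data.Fin.Base using (Fin; zero; suc; toℕ; join; splitAt; _↑ˡ_)
import Data.Fin.Properties as Fin
open import Data.Fin.Subset using (⁅_⁆; _∈_)
open import Data.Fin.Subset.Properties using (x∈⁅x⁆; x∈⁅y⁆⇒x≡y; _∈?_)
open import Data.List.Base
  using (List; []; _∷_; [_]; _++_; length; head; take; drop; foldl; mapMaybe;
         applyUpTo; lookup; allFin; cartesianProductWith; deduplicate)
open import Data.List.Membership.Propositional.Properties
  using (∈-cartesianProductWith⁺; ∈-allFin; ∈-lookup)
import Data.List.Membership.Propositional as List
open import Data.List.Properties
  using (foldl-++; length-++; length-take; length-drop; take-all; take-[]; drop-[];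
         drop-all; take++drop≡id; mapMaybe-++; ∷-injectiveˡ; ≡-dec)
import Data.List.Relation.Unary.All as ListAll
open import Data.List.Relation.Unary.AllPairs using (_∷_)
open import Data.List.Relation.Unary.Any as Any using (here; there; index)
open import Data.List.Relation.Unary.Any.Properties using (lookup-index)
open import Data.List.Relation.Unary.Enumerates.Setoid using (IsEnumeration)
open import Data.List.Relation.Unary.Enumerates.Setoid.Properties using (deduplicate⁺)
open import Data.List.Relation.Unary.Unique.DecSetoid.Properties using (deduplicate-!)
open import Data.List.Relation.Unary.Unique.Setoid using (Unique)
open import Data.Maybe.Base using (Maybe; just; nothing)
open import Data.Maybe.Properties using (just-injective)
open import Data.Nat.Base
open import Data.Nat.ListAction using (sum)
open import Data.Nat.Properties
open import Data.Product.Base using (∃; ∃-syntax; ∃₂; _×_; _,_; proj₁; proj₂)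
open import Data.Sum.Base using (_⊎_; inj₁; inj₂; [_,_]′)
open import Data.Unit.Base using (⊤; tt)
open import Data.Vec.Base as Vec using (Vec; []; _∷_)
open import Data.Vec.Properties using (lookup-map; map-∘; ∷-injective)
open import Data.Vec.Relation.Unary.All as VecAll using ([]; _∷_)
import Data.Vec.Relation.Unary.All.Properties as VecAll
open import Function.Base using (_∘_)
open import Function.Bundles using (Injection; Inverse; Equivalence; mk⇔; _⇔_)
import Function.Construct.Composition as Composition
open import Function.Definitions using (Injective)
open import Function.Properties.Inverse using (Inverse⇒Injection)
open import Level using (Level; 0ℓ) renaming (_⊔_ to _⊔ˡ_)
open import Relation.Binary.Bundles using (Setoid; DecSetoid)
import Relation.Binary.Construct.On as On
open import Relation.Binary.PropositionalEquality
  using (_≡_; _≢_; refl; sym; trans; cong; cong₂; subst; subst₂)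
import Relation.Binary.PropositionalEquality.Properties as ≡
open import Relation.Nullary using (¬_; Dec; yes; no; contradiction)
open import Relation.Nullary.Decidable using (map′; True; toWitness; fromWitness; T?)
open import Relation.Unary using (Pred; Decidable)
open import Defs

private
  variable
    a b ℓ r : Level
    A : Set a
    k n : ℕ

-- Excising loops from accepting runs

excise : ℕ → ℕ → List A → List A
excise i j xs = take i xs ++ drop j xs

excise-beyond : ∀ {i j} (xs : List A) → length xs ≤ i → i ≤ j → excise i j xs ≡ xs
excise-beyond {i = i} {j} xs xs≤i i≤j
  rewrite take-all i xs xs≤i | drop-all j xs (≤-trans xs≤i i≤j) =
  trans (cong (xs ++_) (sym (drop-all (length xs) xs ≤-refl)))
        (trans (cong (_++ drop (length xs) xs) (sym (take-all (length xs) xs ≤-refl)))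
               (take++drop≡id (length xs) xs))

-- The additive form avoids truncated subtraction.
length-excise : ∀ {i j} (xs : List A) → i ≤ j → j ≤ length xs →
                length (excise i j xs) + j ≡ length xs + i
length-excise {i = i} {j} xs i≤j j≤xs = begin
  length (take i xs ++ drop j xs) + j          ≡⟨ cong (_+ j) (length-++ (take i xs)) ⟩
  length (take i xs) + length (drop j xs) + j
    ≡⟨ cong₂ (λ x y → x + y + j)
         (trans (length-take i xs) (m≤n⇒m⊓n≡m (≤-trans i≤j j≤xs))) (length-drop j xs) ⟩
  i + (length xs ∸ j) + j                      ≡⟨ +-assoc i (length xs ∸ j) j ⟩
  i + (length xs ∸ j + j)                      ≡⟨ cong (i +_) (m∸n+n≡m j≤xs) ⟩
  i + length xs                                ≡⟨ +-comm i (length xs) ⟩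
  length xs + i                                ∎
  where open ≡.≡-Reasoning

-- A repetition among s states shows up within the window from m to m + s, and the first m letters
-- stay untouched. The positions do not refer to a word, so one loop can cut a convolution and each
-- of its components alike.
record Loop (m s : ℕ) : Set where
  constructor loop
  field
    {from to} : ℕ
    m≤from  : m ≤ from
    from<to : from < to
    to≤m+s  : to ≤ m + s

  cut : List A → List A
  cut = excise from to

open Loop using (cut)

cut-beyond : ∀ {m s} (l : Loop m s) (xs : List A) → length xs ≤ m → cut l xs ≡ xs
cut-beyond (loop m≤i i<j _) xs xs≤m = excise-beyond xs (≤-trans xs≤m m≤i) (<⇒≤ i<j)

length-cut-< : ∀ {m s} (l : Loop m s) (xs : List A) → m + s ≤ length xs →
               length (cut l xs) < length xs
length-cut-< l@(loop {i} {j} m≤i i<j j≤) xs m+s≤ =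
  +-cancelʳ-< j (length (cut l xs)) (length xs) (begin-strict
    length (cut l xs) + j ≡⟨ length-excise xs (<⇒≤ i<j) (≤-trans j≤ m+s≤) ⟩
    length xs + i         <⟨ +-monoʳ-< (length xs) i<j ⟩
    length xs + j         ∎)
  where open ≤-Reasoning

-- In a window at the front, `to` is at most s, so at most s letters disappear.
length-cut-≥ : ∀ {s} (l : Loop 0 s) (xs : List A) → s ≤ length xs →
               length xs ≤ length (cut l xs) + s
length-cut-≥ {s = s} l@(loop {i} {j} m≤i i<j j≤) xs s≤ = begin
  length xs             ≤⟨ m≤m+n (length xs) i ⟩
  length xs + i         ≡⟨ length-excise xs (<⇒≤ i<j) (≤-trans j≤ s≤) ⟨
  length (cut l xs) + j ≤⟨ +-monoʳ-≤ (length (cut l xs)) j≤ ⟩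
  length (cut l xs) + s ∎
  where open ≤-Reasoning

Cuttable : {A : Set} → Pred (List A) ℓ → ℕ → Set ℓ
Cuttable L s = ∀ m {w} → L w → ∃[ l ] L (cut {m} {s} l w)

-- Pumping down: among the `states` + 1 prefixes `take (m + i) w` two lead to the same state.
-- Prefixes past the end are `w` itself, so short words are covered too, possibly by a trivial cut.
regular⇒cuttable : {A : Set} {L : Pred (List A) ℓ} → Regular L → ∃ (Cuttable L)
regular⇒cuttable {L = L} (M , L⇔M) = states , λ m {w} → cuttable m {w}
  where
  open DFA M
  run : List _ → Fin states
  run = foldl δ start

  cuttable : Cuttable L states
  cuttable m {w} Lw
    with i , j , i<j , same ← Fin.pigeonhole (n<1+n states) (λ i → run (take (m + toℕ i) w))
    = loop (m≤m+n m (toℕ i)) (+-monoʳ-< m i<j) (+-monoʳ-≤ m (s≤s⁻¹ (Fin.toℕ<n j)))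
    , Equivalence.from (L⇔M _) (subst (_∈ accepting) (sym run-cut) (Equivalence.to (L⇔M w) Lw))
    where
    open ≡.≡-Reasoning
    i′ = m + toℕ i
    j′ = m + toℕ j
    run-cut : run (excise i′ j′ w) ≡ run w
    run-cut = begin
      run (excise i′ j′ w)                     ≡⟨ foldl-++ δ start (take i′ w) (drop j′ w) ⟩
      foldl δ (run (take i′ w)) (drop j′ w)    ≡⟨ cong (λ q → foldl δ q (drop j′ w)) same ⟩
      foldl δ (run (take j′ w)) (drop j′ w)    ≡⟨ foldl-++ δ start (take j′ w) (drop j′ w) ⟨
      run (take j′ w ++ drop j′ w)             ≡⟨ cong run (take++drop≡id j′ w) ⟩
      run w                                    ∎

-- Cut repeatedly at the front. While the word is longer than n + s, a cut removes at least one and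
-- at most s letters, so the length cannot jump below n.
shorten : {A : Set} {L : Pred (List A) ℓ} {s : ℕ} → Cuttable L s →
          ∀ n {w} → L w → n ≤ length w → ∃[ v ] L v × n ≤ length v × length v ≤ n + s
shorten {L = L} {s} cuttable n {w} Lw n≤w = go (length w) Lw n≤w ≤-refl
  where
  -- `fuel` bounds the length, which drops strictly with every cut.
  go : ∀ fuel {w} → L w → n ≤ length w → length w ≤ fuel →
       ∃[ v ] L v × n ≤ length v × length v ≤ n + s
  go fuel {w} Lw n≤w w≤fuel with length w ≤? n + s
  ... | yes w≤n+s = w , Lw , n≤w , w≤n+s
  go zero {w} Lw n≤w w≤0 | no w≰n+s = contradiction (≤-trans w≤0 z≤n) w≰n+s
  go (suc fuel) {w} Lw n≤w w≤fuel | no w≰n+s =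
    let n+s≤w = ≰⇒≥ w≰n+s
        s≤w = m+n≤o⇒n≤o n n+s≤w
        l , Lv = cuttable 0 Lw
    in go fuel Lv
         (+-cancelʳ-≤ s n _ (≤-trans n+s≤w (length-cut-≥ l w s≤w)))
         (s≤s⁻¹ (≤-trans (length-cut-< l w s≤w) w≤fuel))

-- Components of convolutions

length≤maxLength : {A : Set} (ws : Vec (List A) n) (i : Fin n) →
                   length (Vec.lookup ws i) ≤ maxLength ws
length≤maxLength (w ∷ ws) zero    = m≤m⊔n (length w) (maxLength ws)
length≤maxLength (w ∷ ws) (suc i) =
  ≤-trans (length≤maxLength ws i) (m≤n⊔m (length w) (maxLength ws))

module _ {A B : Set} (h : B → Maybe A) where

  -- Here `h` reads one track of a sequence `f` of tuples: the track carries `w`, followed by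
  -- `nothing` forever.
  Spells : (ℕ → B) → List A → Set
  Spells f w = ∀ i → h (f i) ≡ head (drop i w)

  spells-[] : ∀ {f} → Spells f [] → Spells (f ∘ suc) []
  spells-[] spells i = trans (spells (suc i)) (cong head (sym (drop-[] i)))

  mapMaybe-applyUpTo : ∀ {f} n {w} → Spells f w → length w ≤ n → mapMaybe h (applyUpTo f n) ≡ w
  mapMaybe-applyUpTo zero    {[]}    spells _ = refl
  mapMaybe-applyUpTo (suc n) {[]}    spells _ rewrite spells 0 =
    mapMaybe-applyUpTo n (spells-[] spells) z≤n
  mapMaybe-applyUpTo (suc n) {x ∷ w} spells (s≤s w≤n) rewrite spells 0 =
    cong (x ∷_) (mapMaybe-applyUpTo n (spells ∘ suc) w≤n)

  -- Under `Spells` every `nothing` comes after the last letter, so discarding them shifts no letter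
  -- to another position. The same reason serves `take` below.
  mapMaybe-drop-applyUpTo : ∀ j {f} n {w} → Spells f w → length w ≤ n →
                            mapMaybe h (drop j (applyUpTo f n)) ≡ drop j w
  mapMaybe-drop-applyUpTo zero    n       spells w≤n = mapMaybe-applyUpTo n spells w≤n
  mapMaybe-drop-applyUpTo (suc j) zero    {[]}    spells _ = refl
  mapMaybe-drop-applyUpTo (suc j) (suc n) {[]}    spells _ =
    trans (mapMaybe-drop-applyUpTo j n (spells-[] spells) z≤n) (drop-[] j)
  mapMaybe-drop-applyUpTo (suc j) (suc n) {x ∷ w} spells (s≤s w≤n) =
    mapMaybe-drop-applyUpTo j n (spells ∘ suc) w≤n

  mapMaybe-take-applyUpTo : ∀ i {f} n {w} → Spells f w → length w ≤ n →
                            mapMaybe h (take i (applyUpTo f n)) ≡ take i w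
  mapMaybe-take-applyUpTo zero    n       spells w≤n = refl
  mapMaybe-take-applyUpTo (suc i) zero    {[]}    spells _ = refl
  mapMaybe-take-applyUpTo (suc i) (suc n) {[]}    spells _ rewrite spells 0 =
    trans (mapMaybe-take-applyUpTo i n (spells-[] spells) z≤n) (take-[] i)
  mapMaybe-take-applyUpTo (suc i) (suc n) {x ∷ w} spells (s≤s w≤n) rewrite spells 0 =
    cong (x ∷_) (mapMaybe-take-applyUpTo i n (spells ∘ suc) w≤n)

component : {A : Set} → Fin n → List (Vec (Maybe A) n) → List A
component c = mapMaybe (λ v → Vec.lookup v c)

-- A cut in a convolution acts on all tracks at the same positions. This turns a loop of the
-- automaton for a relation into simultaneous cuts of the related words.
component-excise-convolution :
  ∀ {A : Set} {n} (ws : Vec (List A) n) (c : Fin n) i j →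
  component c (excise i j (convolution ws)) ≡ excise i j (Vec.lookup ws c)
component-excise-convolution ws c i j = trans
  (mapMaybe-++ letter (take i (convolution ws)) (drop j (convolution ws)))
  (cong₂ _++_
    (mapMaybe-take-applyUpTo letter i (maxLength ws) spells (length≤maxLength ws c))
    (mapMaybe-drop-applyUpTo letter j (maxLength ws) spells (length≤maxLength ws c)))
  where
  letter = λ v → Vec.lookup v c
  spells : Spells letter (λ i → Vec.map (λ w → head (drop i w)) ws) (Vec.lookup ws c)
  spells i = lookup-map c (λ w → head (drop i w)) ws

component-convolution : {A : Set} (ws : Vec (List A) n) (c : Fin n) →
                        component c (convolution ws) ≡ Vec.lookup ws c
-- `excise 0 0` is the identity by computation.
component-convolution ws c = component-excise-convolution ws c 0 0

Determined : {A : Set} → Pred (Vec (List A) n) ℓ → Fin n → Set ℓ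
Determined R c = ∀ {ws vs} → R ws → R vs →
  (∀ d → d ≢ c → Vec.lookup ws d ≡ Vec.lookup vs d) → Vec.lookup ws c ≡ Vec.lookup vs c

LengthBounded : {A : Set} → Pred (Vec (List A) n) ℓ → Fin n → ℕ → Set ℓ
LengthBounded R c t = ∀ m {ws} → R ws → (∀ d → d ≢ c → length (Vec.lookup ws d) ≤ m) →
  length (Vec.lookup ws c) < m + t

-- Cut the convolution beyond position m. Components of length at most m survive, so `Determined`
-- forces component c to survive as well; but with m + t letters or more it would become shorter.
-- The number t of states serves all c at once.
determined⇒lengthBounded :
  {A : Set} {R : Pred (Vec (List A) n) ℓ} → RegularRelation R →
  ∃[ t ] ∀ c → Determined R c → LengthBounded R c t
determined⇒lengthBounded {R = R} regular
  with t , cuttable ← regular⇒cuttable regular = t , bounded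
  where
  bounded : ∀ c → Determined R c → LengthBounded R c t
  bounded c determined m {ws} Rws others≤m
    -- The automaton accepts only convolutions of tuples in `R`, so the cut word is again one, say
    -- of `vs`.
    with l , vs , Rvs , cut≡ ← cuttable m (ws , Rws , refl)
    = ≰⇒> λ m+t≤ → <-irrefl (cong length (sym shorter≡)) (length-cut-< l (Vec.lookup ws c) m+t≤)
    where
    lookup-vs : ∀ d → Vec.lookup vs d ≡ cut l (Vec.lookup ws d)
    lookup-vs d = trans (sym (component-convolution vs d))
      (trans (cong (component d) (sym cut≡))
        (component-excise-convolution ws d (Loop.from l) (Loop.to l)))

    shorter≡ : Vec.lookup ws c ≡ cut l (Vec.lookup ws c)
    shorter≡ = trans
      (determined Rws Rvs λ d d≢c →
        sym (trans (lookup-vs d) (cut-beyond l (Vec.lookup ws d) (others≤m d d≢c))))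
      (lookup-vs c)

-- Exponential growth

record Family {A : Set} (L : Pred (List A) ℓ) (N m : ℕ) : Set ℓ where
  field
    member     : Fin N → List A
    injective  : Injective _≡_ _≡_ member
    inLanguage : ∀ i → L (member i)
    bounded    : ∀ i → length (member i) ≤ m

family≤growth : {A : Set} {L : Pred (List A) ℓ} {N m M : ℕ} → Family L N m →
  languageSetoid (λ w → L w × length w ≤ m) HasAtMost M Elements → N ≤ M
family≤growth F embedding =
  Fin.injective⇒≤ {f = λ i → to (member i , inLanguage i , bounded i)}
    (injective ∘ Injection.injective embedding)
  where
  open Family F
  open Injection embedding using (to)

join-families : {A : Set} {L : Pred (List A) ℓ} {N N′ m : ℕ}
                (F : Family L N m) (F′ : Family L N′ m) →
                (∀ i j → Family.member F i ≢ Family.member F′ j) → Family L (N + N′) m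
join-families {L = L} {N} {N′} {m} F F′ disjoint = record
  { member     = f ∘ splitAt N
  ; injective  = λ {i} {j} eq → trans (sym (Fin.join-splitAt N N′ i))
      (trans (cong (join N N′) (f-injective (splitAt N i) (splitAt N j) eq))
             (Fin.join-splitAt N N′ j))
  ; inLanguage = inL ∘ splitAt N
  ; bounded    = f≤m ∘ splitAt N
  }
  where
  module F = Family F
  module F′ = Family F′
  f : Fin N ⊎ Fin N′ → List _
  f = [ F.member , F′.member ]′

  f-injective : ∀ x y → f x ≡ f y → x ≡ y
  f-injective (inj₁ i) (inj₁ j) eq = cong inj₁ (F.injective eq)
  f-injective (inj₁ i) (inj₂ j) eq = contradiction eq (disjoint i j)
  f-injective (inj₂ i) (inj₁ j) eq = contradiction (sym eq) (disjoint j i)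
  f-injective (inj₂ i) (inj₂ j) eq = cong inj₂ (F′.injective eq)

  inL : ∀ x → L (f x)
  inL (inj₁ i) = F.inLanguage i
  inL (inj₂ i) = F′.inLanguage i

  f≤m : ∀ x → length (f x) ≤ m
  f≤m (inj₁ i) = F.bounded i
  f≤m (inj₂ i) = F′.bounded i

weaken : {A : Set} {L : Pred (List A) ℓ} {N m n : ℕ} → m ≤ n → Family L N m → Family L N n
weaken m≤n F = record
  { Family F using (member; injective; inLanguage)
  ; bounded = λ i → ≤-trans (Family.bounded F i) m≤n
  }

-- This is all that the growth argument uses of a group. `determined` is right cancellation, left
-- cancellation and uniqueness of the product, for c = 0, 1, 2.
record CancellativeProduct {A : Set} (L : Pred (List A) ℓ) (R : Pred (Vec (List A) 3) r) :
                           Set (ℓ ⊔ˡ r) where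
  field
    total      : ∀ {x y} → L x → L y → ∃[ z ] L z × R (x ∷ y ∷ z ∷ [])
    determined : ∀ c → Determined R c

module ExponentialGrowth
  {A : Set} {L : Pred (List A) ℓ} {R : Pred (Vec (List A) 3) r}
  (cancellative : CancellativeProduct L R)
  {s t : ℕ} (cuttable : Cuttable L s) (lengthBounded : ∀ c → LengthBounded R c t)
  where

  open CancellativeProduct cancellative

  -- The growth of the length bound in one doubling: `t + s` for the length of the multiplier `g`,
  -- and another `t` for the products.
  step : ℕ
  step = t + s + t

  double : ∀ {N m w} → Family L N m → L w → m + t ≤ length w → Family L (N + N) (step + m)
  double {N} {m} F Lw m+t≤w
    with g , Lg , m+t≤g , g≤m+t+s ← shorten cuttable (m + t) Lw m+t≤w
    = join-families (weaken (m≤n+m m step) F) F∙g disjoint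
    where
    open Family F
    _∙g : Fin N → List A
    i ∙g = proj₁ (total (inLanguage i) Lg)

    ∙g-product : ∀ i → R (member i ∷ g ∷ i ∙g ∷ [])
    ∙g-product i = proj₂ (proj₂ (total (inLanguage i) Lg))

    disjoint : ∀ i j → member i ≢ j ∙g
    -- If a product were a member, both it and its left factor would have length at most m, forcing
    -- `g` below m + t.
    disjoint i j eq = <⇒≱
      (lengthBounded (suc zero) m (∙g-product j) λ
        { zero             _   → bounded j
        ; (suc zero)       1≢1 → contradiction refl 1≢1
        ; (suc (suc zero)) _   → subst (λ w → length w ≤ m) eq (bounded i)
        })
      m+t≤g

    F∙g : Family L N (step + m)
    F∙g = record
      { member     = _∙g
      ; injective  = λ {i} {j} eq → injective
          (determined zero (∙g-product i) (∙g-product j) λ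
            { zero             0≢0 → contradiction refl 0≢0
            ; (suc zero)       _   → refl
            ; (suc (suc zero)) _   → eq
            })
      ; inLanguage = λ i → proj₁ (proj₂ (total (inLanguage i) Lg))
      ; bounded    = λ i → subst (length (i ∙g) ≤_) rearrange (<⇒≤
          (lengthBounded (suc (suc zero)) (m + t + s) (∙g-product i) λ
            { zero             _   → ≤-trans (bounded i) (≤-trans (m≤m+n m t) (m≤m+n (m + t) s))
            ; (suc zero)       _   → g≤m+t+s
            ; (suc (suc zero)) 2≢2 → contradiction refl 2≢2
            }))
      }
      where
      rearrange : m + t + s + t ≡ step + m
      rearrange = trans (cong (_+ t) (+-assoc m t s))
        (trans (+-assoc m (t + s) t) (+-comm m step))

  -- Start from a single word, shortened to at most `s` letters, and double k times. The long word
  -- `w` is the source from which each doubling obtains its multiplier by `shorten`.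
  family : ∀ k {w} → L w → k * step + s ≤ length w → Family L (2 ^ k) (k * step + s)
  family zero Lw _ with v , Lv , _ , v≤s ← shorten cuttable 0 Lw z≤n = record
    { member     = λ _ → v
    ; injective  = λ { {zero} {zero} _ → refl }
    ; inLanguage = λ _ → Lv
    ; bounded    = λ _ → v≤s
    }
  family (suc k) {w} Lw long = subst₂ (Family L)
    (cong (2 ^ k +_) (sym (+-identityʳ (2 ^ k))))
    (sym (+-assoc step (k * step) s))
    (double (family k Lw (≤-trans (+-monoˡ-≤ s (m≤n+m (k * step) step)) long)) Lw m+t≤w)
    where
    open ≤-Reasoning
    m = k * step + s
    m+t≤w : m + t ≤ length w
    m+t≤w = begin
      m + t                  ≤⟨ +-monoʳ-≤ m (m≤n+m t (t + s)) ⟩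
      m + step               ≡⟨ +-comm m step ⟩
      step + m               ≡⟨ +-assoc step (k * step) s ⟨
      suc k * step + s       ≤⟨ long ⟩
      length w               ∎

-- Exponentials outgrow polynomials

n<2^n : ∀ n → n < 2 ^ n
n<2^n zero    = s≤s z≤n
n<2^n (suc n) = begin-strict
  suc n               ≤⟨ n<2^n n ⟩
  2 ^ n               <⟨ m<m+n (2 ^ n) (m^n>0 2 n) ⟩
  2 ^ n + 2 ^ n       ≡⟨ cong (2 ^ n +_) (+-identityʳ (2 ^ n)) ⟨
  2 ^ suc n           ∎
  where open ≤-Reasoning

linear≤2^ : ∀ a d → ∃[ j ] a + j * d ≤ 2 ^ j
-- An even exponent makes the power the square of 2 ^ i. Since i = a + 2d dominates both a and 2d,
-- the linear term is at most (i + 1) * i, and each factor is at most 2 ^ i.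
linear≤2^ a d = i + i , (begin
  a + (i + i) * d             ≤⟨ +-monoˡ-≤ ((i + i) * d) (m≤m+n a (d + d)) ⟩
  i + (i + i) * d             ≡⟨ cong (i +_) (trans (*-distribʳ-+ d i i) (sym (*-distribˡ-+ i d d))) ⟩
  i + i * (d + d)             ≤⟨ +-monoʳ-≤ i (*-monoʳ-≤ i (m≤n+m (d + d) a)) ⟩
  suc i * i                   ≤⟨ *-mono-≤ (n<2^n i) (<⇒≤ (n<2^n i)) ⟩
  2 ^ i * 2 ^ i               ≡⟨ ^-distribˡ-+-* 2 i i ⟨
  2 ^ (i + i)                 ∎)
  where
  open ≤-Reasoning
  i = a + (d + d)

-- As n is at least 1, every coefficient can be moved up to the common exponent `length p`.
eval≤monomial : ∀ p n .{{_ : NonZero n}} → eval p n ≤ sum p * n ^ length p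
eval≤monomial []      n = z≤n
eval≤monomial (c ∷ p) n = begin
  c + n * eval p n                              ≤⟨ +-mono-≤ c≤ (*-monoʳ-≤ n (eval≤monomial p n)) ⟩
  c * n ^ suc d + n * (sum p * n ^ d)           ≡⟨ cong (c * n ^ suc d +_) swap ⟩
  c * n ^ suc d + sum p * n ^ suc d             ≡⟨ *-distribʳ-+ (n ^ suc d) c (sum p) ⟨
  (c + sum p) * n ^ suc d                       ∎
  where
  open ≤-Reasoning
  d = length p
  c≤ : c ≤ c * n ^ suc d
  c≤ = m≤m*n c (n ^ suc d) {{m^n≢0 n (suc d)}}
  swap : n * (sum p * n ^ d) ≡ sum p * n ^ suc d
  swap = trans (sym (*-assoc n (sum p) (n ^ d)))
    (trans (cong (_* n ^ d) (*-comm n (sum p))) (*-assoc (sum p) n (n ^ d)))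

-- With k = 2 ^ j, the argument n can be chosen as a power of 2 whose exponent is
-- linear in j, so that eval p n is bounded by such a power as well.
polynomial<exponential : ∀ p C D → ∃₂ λ k n → k * C + D ≤ n × eval p n < 2 ^ k
polynomial<exponential p C D with j , linear ← linear≤2^ (sum p + (C + D) * length p) (length p)
  = 2 ^ j , 2 ^ e , k*C+D≤n , eval<
  where
  open ≤-Reasoning
  d = length p
  e = j + (C + D)
  k*C+D≤n : 2 ^ j * C + D ≤ 2 ^ e
  k*C+D≤n = begin
    2 ^ j * C + D               ≤⟨ +-monoʳ-≤ (2 ^ j * C) (m≤n*m D (2 ^ j) {{m^n≢0 2 j}}) ⟩
    2 ^ j * C + 2 ^ j * D       ≡⟨ *-distribˡ-+ (2 ^ j) C D ⟨
    2 ^ j * (C + D)             ≤⟨ *-monoʳ-≤ (2 ^ j) (<⇒≤ (n<2^n (C + D))) ⟩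
    2 ^ j * 2 ^ (C + D)         ≡⟨ ^-distribˡ-+-* 2 j (C + D) ⟨
    2 ^ e                       ∎
  exponent : sum p + e * d ≤ 2 ^ j
  exponent = begin
    sum p + e * d                     ≡⟨ cong (sum p +_) (*-distribʳ-+ d j (C + D)) ⟩
    sum p + (j * d + (C + D) * d)     ≡⟨ cong (sum p +_) (+-comm (j * d) _) ⟩
    sum p + ((C + D) * d + j * d)     ≡⟨ +-assoc (sum p) _ (j * d) ⟨
    sum p + (C + D) * d + j * d       ≤⟨ linear ⟩
    2 ^ j                             ∎
  eval< : eval p (2 ^ e) < 2 ^ (2 ^ j)
  eval< = begin-strict
    eval p (2 ^ e)                    ≤⟨ eval≤monomial p (2 ^ e) {{m^n≢0 2 e}} ⟩
    sum p * (2 ^ e) ^ d               ≡⟨ cong (sum p *_) (^-*-assoc 2 e d) ⟩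
    sum p * 2 ^ (e * d)               <⟨ *-monoˡ-< (2 ^ (e * d)) {{m^n≢0 2 (e * d)}} (n<2^n (sum p)) ⟩
    2 ^ sum p * 2 ^ (e * d)           ≡⟨ ^-distribˡ-+-* 2 (sum p) (e * d) ⟨
    2 ^ (sum p + e * d)               ≤⟨ ^-monoʳ-≤ 2 exponent ⟩
    2 ^ (2 ^ j)                       ∎

-- Choose k and n such that 2 ^ k exceeds the growth polynomial at n, where n is at least the length
-- bound after k doublings. A word longer than that bound would give 2 ^ k words of length at most
-- n.
cancellative⇒bounded :
  {A : Set} {L : Pred (List A) ℓ} {R : Pred (Vec (List A) 3) r} →
  Regular L → RegularRelation R → PolynomialGrowth L → CancellativeProduct L R →
  ∃[ m ] ∀ {w} → L w → length w ≤ m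
cancellative⇒bounded L-regular R-regular (p , growth) cancellative
  with s , cuttable ← regular⇒cuttable L-regular
     | t , bounded ← determined⇒lengthBounded R-regular
  with lengthBounded ← (λ c → bounded c (CancellativeProduct.determined cancellative c))
  with k , n , m≤n , eval<2^k ← polynomial<exponential p (t + s + t) s
  = k * (t + s + t) + s , λ Lw → ≮⇒≥ λ m<w →
      let open ExponentialGrowth cancellative cuttable lengthBounded
      in <⇒≱ eval<2^k (family≤growth (weaken m≤n (family k Lw (<⇒≤ m<w))) (growth n))

-- Finite languages

lookup-injective : (S : Setoid a ℓ) {xs : List (Setoid.Carrier S)} → Unique S xs →
                   Injective _≡_ (Setoid._≈_ S) (lookup xs)
lookup-injective S {_ ∷ xs} _         {zero}  {zero}  _  = refl
lookup-injective S {_ ∷ xs} (x∉ ∷ _)  {zero}  {suc j} eq =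
  contradiction eq (ListAll.lookup x∉ (∈-lookup j))
lookup-injective S {_ ∷ xs} (x∉ ∷ _)  {suc i} {zero}  eq =
  contradiction (Setoid.sym S eq) (ListAll.lookup x∉ (∈-lookup i))
lookup-injective S {_ ∷ xs} (_ ∷ !xs) {suc i} {suc j} eq =
  cong suc (lookup-injective S !xs eq)

enumeration⇒finite : (S : DecSetoid a ℓ) {xs : List (DecSetoid.Carrier S)} →
                     IsEnumeration (DecSetoid.setoid S) xs → Finite (DecSetoid.setoid S)
enumeration⇒finite S {xs} enumerates = length ys , record
  { to        = lookup ys
  ; from      = λ x → index (x∈ys x)
  ; to-cong   = λ { refl → S.refl }
  -- The index comes from a membership proof, but equal elements get the same index because `ys` has
  -- no repetitions.
  ; from-cong = λ {x} {y} x≈y → injective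
      (S.trans (S.sym (lookup-index (x∈ys x))) (S.trans x≈y (lookup-index (x∈ys y))))
  ; inverse   = (λ { {x} refl → S.sym (lookup-index (x∈ys x)) })
              , (λ {i} {x} x≈yᵢ → injective (S.trans (S.sym (lookup-index (x∈ys x))) x≈yᵢ))
  }
  where
  module S = DecSetoid S
  ys = deduplicate S._≟_ xs
  x∈ys : IsEnumeration S.setoid ys
  x∈ys = deduplicate⁺ S enumerates
  injective : Injective _≡_ S._≈_ (lookup ys)
  injective = lookup-injective S.setoid (deduplicate-! S xs)

wordsUpTo : (k m : ℕ) → List (Word k)
wordsUpTo k zero    = [ [] ]
wordsUpTo k (suc m) = [] ∷ cartesianProductWith _∷_ (allFin k) (wordsUpTo k m)

∈-wordsUpTo : ∀ m (w : Word k) → length w ≤ m → w List.∈ wordsUpTo k m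
∈-wordsUpTo zero    []      _         = here refl
∈-wordsUpTo (suc m) []      _         = here refl
∈-wordsUpTo (suc m) (x ∷ w) (s≤s w≤m) =
  there (∈-cartesianProductWith⁺ _∷_ (∈-allFin x) (∈-wordsUpTo m w w≤m))

module _ {A : Set a} {P : Pred A ℓ} (P? : Decidable P) where

  restrict : List A → List (∃ P)
  restrict []       = []
  restrict (x ∷ xs) with P? x
  ... | yes Px = (x , Px) ∷ restrict xs
  ... | no  _  = restrict xs

  -- `P?` may return another proof than the given one, so only first components are compared, as in
  -- `languageSetoid`.
  ∈-restrict : ∀ {x xs} → P x → x List.∈ xs → Any.Any (λ y → x ≡ proj₁ y) (restrict xs)
  ∈-restrict {xs = y ∷ _} Px x∈ with P? y | x∈
  ... | yes Py | here x≡y  = here x≡y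
  ... | yes Py | there x∈′ = there (∈-restrict Px x∈′)
  ... | no ¬Py | here refl = contradiction Px ¬Py
  ... | no ¬Py | there x∈′ = ∈-restrict Px x∈′

-- Running the automaton decides `L`, so the finite list of all words up to length m can be
-- filtered.
bounded⇒finite : {L : Pred (Word k) ℓ} → Regular L → ∀ {m} → (∀ {w} → L w → length w ≤ m) →
                 Finite (languageSetoid L)
bounded⇒finite {k = k} {L = L} (M , L⇔M) {m} bounded = enumeration⇒finite
  (On.decSetoid (≡.decSetoid (≡-dec Fin._≟_)) proj₁)
  (λ (w , Lw) → ∈-restrict L? Lw (∈-wordsUpTo m w (bounded Lw)))
  where
  open DFA M
  L? : Decidable L
  L? w = map′ (Equivalence.from (L⇔M w)) (Equivalence.to (L⇔M w))
    (foldl δ start w ∈? accepting)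

-- Groups with a presentation of polynomial growth

polyGrowthAutomatic⇒finite : (G : Group a ℓ) → PolyGrowthAutomatic (groupStructure G) →
                             Finite (Group.setoid G)
polyGrowthAutomatic⇒finite G (P , growth) =
  let m , bounded = cancellative⇒bounded universe-regular (relation-regular product) growth
                      cancellativeProduct
      n , enumeration = bounded⇒finite universe-regular bounded
  in n , Composition.inverse enumeration bijection
  where
  open AutomaticPresentation P
  open _≅_ isomorphic
  module G = Group G
  open import Algebra.Properties.Group G using (∙-cancelˡ; ∙-cancelʳ)

  R : Pred (Vec (Word alphabetSize) 3) 0ℓ
  R = relation product

  -- In particular, the element denoted by a word is independent of the proof that the word lies in
  -- the universe.
  to-cong : ∀ {x y} → proj₁ x ≡ proj₁ y → to x G.≈ to y
  to-cong {x} {y} = Inverse.to-cong bijection {x} {y}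

  to-injective : ∀ {x y} → to x G.≈ to y → proj₁ x ≡ proj₁ y
  to-injective = Injection.injective (Inverse⇒Injection bijection)

  product-sound : ∀ {x y z} → R (x ∷ y ∷ z ∷ []) →
                  ∃[ Lx ] ∃[ Ly ] ∃[ Lz ] to (x , Lx) G.∙ to (y , Ly) G.≈ to (z , Lz)
  product-sound Rxyz with Lx ∷ Ly ∷ Lz ∷ [] ← within product Rxyz =
    Lx , Ly , Lz , Equivalence.to (rel-⇔ product ((_ , Lx) ∷ (_ , Ly) ∷ (_ , Lz) ∷ [])) Rxyz

  product-determined : ∀ c → Determined R c
  product-determined c {x ∷ y ∷ z ∷ []} {x′ ∷ y′ ∷ z′ ∷ []} Rws Rvs others
    with Lx , Ly , Lz , xy≈z ← product-sound Rws
       | Lx′ , Ly′ , Lz′ , x′y′≈z′ ← product-sound Rvs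
    -- The three cases are right cancellation, left cancellation and functionality of the product,
    -- pulled back along the isomorphism.
    with c
  ... | zero = to-injective (∙-cancelʳ (to (y , Ly)) _ _ (G.trans xy≈z (G.trans
        (to-cong (others (suc (suc zero)) λ ()))
        (G.trans (G.sym x′y′≈z′) (G.∙-congˡ (G.sym (to-cong (others (suc zero) λ ()))))))))
  ... | suc zero = to-injective (∙-cancelˡ (to (x , Lx)) _ _ (G.trans xy≈z (G.trans
        (to-cong (others (suc (suc zero)) λ ()))
        (G.trans (G.sym x′y′≈z′) (G.∙-congʳ (G.sym (to-cong (others zero λ ()))))))))
  ... | suc (suc zero) = to-injective (G.trans (G.sym xy≈z) (G.trans
        (G.∙-cong (to-cong (others zero λ ())) (to-cong (others (suc zero) λ ()))) x′y′≈z′))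

  cancellativeProduct : CancellativeProduct universe R
  cancellativeProduct = record
    { total      = λ {x} {y} Lx Ly →
        let z , Lz = from (to (x , Lx) G.∙ to (y , Ly))
        in z , Lz , Equivalence.from (rel-⇔ product ((x , Lx) ∷ (y , Ly) ∷ (z , Lz) ∷ []))
             (G.sym (Inverse.strictlyInverseˡ bijection _))
    ; determined = product-determined
    }

-- Presentations of finite structures

regular-resp-⇔ : {A : Set} {L : Pred (List A) ℓ} {L′ : Pred (List A) r} →
                 (∀ w → L w ⇔ L′ w) → Regular L → Regular L′
regular-resp-⇔ L⇔L′ (M , L⇔M) = M , λ w →
  mk⇔ (Equivalence.to (L⇔M w) ∘ Equivalence.from (L⇔L′ w))
      (Equivalence.to (L⇔L′ w) ∘ Equivalence.from (L⇔M w))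

-- The state `final` is reached after exactly one letter, if it satisfies `P`; any further letter
-- leads to `dead`. The transition function may consult `P?`.
letters-regular : {A : Set} {P : Pred A ℓ} → Decidable P → Regular (λ u → ∃[ x ] P x × u ≡ [ x ])
letters-regular {A = A} {P} P? = M , λ u → mk⇔ complete (sound u)
  where
  pattern initial = zero
  pattern final   = suc zero
  pattern dead    = suc (suc zero)

  δ : Fin 3 → A → Fin 3
  δ initial x with P? x
  ... | yes _ = final
  ... | no  _ = dead
  δ final x = dead
  δ dead  x = dead

  M : DFA A
  M = record { states = 3 ; start = initial ; δ = δ ; accepting = ⁅ final ⁆ }

  dead-stays : ∀ u → foldl δ dead u ≡ dead
  dead-stays []      = refl
  dead-stays (_ ∷ u) = dead-stays u

  complete : ∀ {u} → ∃[ x ] P x × u ≡ [ x ] → DFA.Accepts M u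
  complete (x , Px , refl) with P? x
  ... | yes _  = x∈⁅x⁆ final
  ... | no ¬Px = contradiction Px ¬Px

  dead-rejects : ∀ u → ¬ foldl δ dead u ∈ DFA.accepting M
  dead-rejects u accepts with () ← trans (sym (dead-stays u)) (x∈⁅y⁆⇒x≡y {n = 3} final accepts)

  sound : ∀ u → DFA.Accepts M u → ∃[ x ] P x × u ≡ [ x ]
  sound [] accepts with () ← x∈⁅y⁆⇒x≡y {n = 3} {x = initial} final accepts
  sound (x ∷ u) accepts with P? x
  sound (x ∷ [])    accepts | yes Px = x , Px , refl
  sound (x ∷ y ∷ u) accepts | yes _  = contradiction accepts (dead-rejects u)
  sound (x ∷ u)     accepts | no  _  = contradiction accepts (dead-rejects u)

module _ {A : Set} where

  maxLength-letters : .{{_ : NonZero n}} (xs : Vec A n) → maxLength (Vec.map [_] xs) ≡ 1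
  maxLength-letters (x ∷ [])     = refl
  maxLength-letters (x ∷ y ∷ xs) = cong (1 ⊔_) (maxLength-letters (y ∷ xs))

  -- All components have length 1, so there is one column and no □ in it. For n = 0 the convolution
  -- would be empty, whence `NonZero n`.
  convolution-letters : .{{_ : NonZero n}} (xs : Vec A n) →
                        convolution (Vec.map [_] xs) ≡ [ Vec.map just xs ]
  convolution-letters xs rewrite maxLength-letters xs = cong [_] (sym (map-∘ head [_] xs))

  map-injective : {B : Set b} {f : A → B} → Injective _≡_ _≡_ f →
                  Injective _≡_ _≡_ (Vec.map {n = n} f)
  map-injective inj {[]}     {[]}     _  = refl
  map-injective inj {x ∷ xs} {y ∷ ys} eq =
    cong₂ _∷_ (inj (proj₁ (∷-injective eq))) (map-injective inj (proj₂ (∷-injective eq)))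

  allJust? : (ms : Vec (Maybe A) n) → Dec (∃[ xs ] ms ≡ Vec.map just xs)
  allJust? []             = yes ([] , refl)
  allJust? (nothing ∷ ms) = no λ { (_ ∷ _ , ()) }
  allJust? (just x ∷ ms)  = map′
    (λ { (xs , refl) → x ∷ xs , refl })
    (λ { (_ ∷ xs , eq) → xs , proj₂ (∷-injective eq) })
    (allJust? ms)

  justs? : {Q : Pred (Vec A n) ℓ} → Decidable Q →
           Decidable (λ ms → ∃[ xs ] Q xs × ms ≡ Vec.map just xs)
  justs? {Q = Q} Q? ms with allJust? ms
  ... | no ¬just = no λ (xs , _ , eq) → ¬just (xs , eq)
  ... | yes (xs , refl) = map′ (λ Qxs → xs , Qxs , refl)
    (λ (ys , Qys , eq) → subst Q (sym (map-injective just-injective eq)) Qys) (Q? xs)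

  Letters : Pred (Vec A n) ℓ → Pred (Vec (List A) n) ℓ
  Letters Q ws = ∃[ xs ] Q xs × ws ≡ Vec.map [_] xs

  -- The convolutions are one-letter words, and their letters are recognised by checking first for □
  -- and then for `Q`.
  letters-relation-regular : {Q : Pred (Vec A n) ℓ} .{{_ : NonZero n}} → Decidable Q →
                             RegularRelation (Letters Q)
  letters-relation-regular Q? = regular-resp-⇔
    (λ u → mk⇔
      (λ { (_ , (xs , Qxs , refl) , refl) →
             Vec.map [_] xs , (xs , Qxs , refl) , sym (convolution-letters xs) })
      (λ { (_ , (xs , Qxs , refl) , refl) →
             Vec.map just xs , (xs , Qxs , refl) , convolution-letters xs }))
    (letters-regular (justs? Q?))

module _ {S : Signature} (𝔄 : Structure S a ℓ r) where

  open Structure 𝔄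

  finite⇒polyGrowthAutomatic : (∀ s → NonZero (arity S s)) → (∀ s → Decidable (rel s)) →
                               Finite setoid → PolyGrowthAutomatic 𝔄
  -- Elements are coded by one-letter words over an alphabet of size n, so the constant polynomial n
  -- bounds the growth. It evaluates at m to `n + m * 0`, hence the embedding by `↑ˡ`.
  finite⇒polyGrowthAutomatic arity≢0 rel? (n , enumeration) = presentation , n ∷ [] , λ m → record
    { to        = λ (_ , (i , _) , _) → i ↑ˡ (m * 0)
    ; cong      = λ { {_ , (_ , refl) , _} {_ , (_ , refl) , _} refl → refl }
    ; injective = λ { {_ , (i , refl) , _} {_ , (j , refl) , _} eq →
                        cong [_] (Fin.↑ˡ-injective (m * 0) i j eq) }
    }
    where
    open Inverse enumeration using (to)

    -- `True` of the decision replaces a relation of level `r` by an equivalent one of level 0, as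
    -- `WordStructure` demands.
    Holds : (s : Symbol S) → Pred (Vec (Fin n) (arity S s)) 0ℓ
    Holds s is = True (rel? s (Vec.map to is))

    IsLetter : Pred (Word n) 0ℓ
    IsLetter w = ∃[ i ] w ≡ [ i ]

    letter : ∃ IsLetter → Fin n
    letter = proj₁ ∘ proj₂

    words : WordStructure S n
    words = record
      { universe = IsLetter
      ; relation = λ s → Letters (Holds s)
      ; within   = λ { s (is , _ , refl) → VecAll.map⁺ (VecAll.universal (λ i → i , refl) is) }
      }

    decode : Inverse (languageSetoid IsLetter) (≡.setoid (Fin n))
    decode = record
      { to        = letter
      ; from      = λ i → [ i ] , i , refl
      ; to-cong   = λ { {_ , _ , refl} {_ , _ , refl} refl → refl }
      ; from-cong = cong [_]
      ; inverse   = (λ { {_} {_ , _ , refl} refl → refl }) , (λ { {_ , _ , refl} refl → refl })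
      }

    map-proj₁ : ∀ {k} (xs : Vec (∃ IsLetter) k) → Vec.map proj₁ xs ≡ Vec.map [_] (Vec.map letter xs)
    map-proj₁ []                   = refl
    map-proj₁ ((_ , _ , refl) ∷ xs) = cong (_ ∷_) (map-proj₁ xs)

    presentation : AutomaticPresentation 𝔄
    presentation = record
      { alphabetSize     = n
      ; wordStructure    = words
      ; universe-regular = regular-resp-⇔
          (λ w → mk⇔ (λ (i , _ , eq) → i , eq) (λ (i , eq) → i , tt , eq))
          (letters-regular {P = λ _ → ⊤} (λ _ → yes tt))
      ; relation-regular = λ s → letters-relation-regular {{arity≢0 s}} (λ is → T? _)
      ; isomorphic       = record
        { bijection = Composition.inverse decode enumeration
        ; rel-⇔     = λ s xs → mk⇔
            -- Distinct tuples of letters give distinct tuples of words, so `is` consists of the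
            -- letters of `xs`.
            (λ (is , holds , eq) → subst (rel s)
              (trans (cong (Vec.map to) (map-injective ∷-injectiveˡ (trans (sym eq) (map-proj₁ xs))))
                     (sym (map-∘ to letter xs)))
              (toWitness holds))
            (λ holds → Vec.map letter xs
                     , fromWitness (subst (rel s) (map-∘ to letter xs) holds)
                     , map-proj₁ xs)
        }
      }

-- Finite groups

finite⇒dec : (S : Setoid a ℓ) → Finite S → ∀ x y → Dec (Setoid._≈_ S x y)
finite⇒dec S (_ , enumeration) x y = map′
  (λ eq → S.trans (S.sym (strictlyInverseˡ x)) (S.trans (to-cong eq) (strictlyInverseˡ y)))
  from-cong
  (from x Fin.≟ from y)
  where
  module S = Setoid S
  open Inverse enumeration

-- Each graph is given by an equation, which is decided by comparing indices in the enumeration.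
finite⇒groupRel? : (G : Group a ℓ) → Finite (Group.setoid G) → ∀ s → Decidable (groupRel G s)
finite⇒groupRel? G finite = λ
  { product  (x ∷ y ∷ z ∷ []) → (x ∙ y) ≈? z
  ; inverse  (x ∷ y ∷ [])     → (x ⁻¹) ≈? y
  ; identity (x ∷ [])         → ε ≈? x
  }
  where
  open Group G
  _≈?_ = finite⇒dec setoid finite

theorem5p12 : ∀ {c ℓ} (G : Group c ℓ) → PolyGrowthAutomatic (groupStructure G) ⇔ Finite (Group.setoid G)
theorem5p12 G = mk⇔
  (polyGrowthAutomatic⇒finite G)
  (λ finite → finite⇒polyGrowthAutomatic (groupStructure G)
    (λ { product → _ ; inverse → _ ; identity → _ })
    (finite⇒groupRel? G finite) finite)
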